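{- In constructive dependent type theory, without any additional axioms, both the weak partial value constructor $\mathfrak{P}$ and the weak value constructor $\mathfrak{V}$ are monads on stable setoids. That is, for $\mathfrak{M}=\mathfrak{P}$ and for $\mathfrak{M}=\mathfrak{V}$: $\mathfrak{M}$ takes stable setoids to stable setoids; the operations $\mathrm{unit}_{\mathfrak{M}}\colon X\to\mathfrak{M}X$, $\mathrm{map}_{\mathfrak{M}}\colon (X\to Y)\to\mathfrak{M}X\to\mathfrak{M}Y$ and $\mathrm{join}_{\mathfrak{M}}\colon\mathfrak{M}(\mathfrak{M}X)\to\mathfrak{M}X$ given in the context are well defined (they take values in the indicated setoids and respect the setoid equivalences) for all stable setoids $X,Y$; and for all stable setoids $W,X,Y,Z$ and all respectful functions $f\colon Y\to\mathfrak{M}Z$, $g\colon X\to\mathfrak{M}Y$, $h\colon W\to\mathfrak{M}X$, $$f\lll\mathrm{unit}_{\mathfrak{M}}\asymp f,\qquad \mathrm{unit}_{\mathfrak{M}}\lll f\asymp f,\qquad f\lll(g\lll h)\asymp(f\lll g)\lll h,$$ where $\mathrm{bind}_{\mathfrak{M}}\,k:=\mathrm{join}_{\mathfrak{M}}\circ(\mathrm{map}_{\mathfrak{M}}\,k)$ and $k\lll l:=(\mathrm{bind}_{\mathfrak{M}}\,k)\circ l$.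
   Context: The ambient logic is constructive (intuitionistic) dependent type theory (prototyped in Coq); no excluded middle, choice or other axiom is assumed. $\star$ denotes the kind of types/propositions (predicates are $\star$-valued; in Coq, $\mathrm{Prop}$-valued). $\neg\varphi:=\varphi\Rightarrow\bot$; $\Sigma$ is the constructive existential (dependent pair type); the weak (classical) existential is $\exists a\colon A.\,\varphi(a):=\neg\forall a\colon A.\,\neg\varphi(a)$. A proposition $\varphi$ is stable if $\neg\neg\varphi\Rightarrow\varphi$. A setoid $X$ is a type together with an equivalence relation $\asymp_X$; it is a stable setoid if $x\asymp_X y$ is a stable proposition for all $x,y$. For setoids $X,Y$, $X\to Y$ is the setoid of respectful functions (functions $f$ with $x\asymp y\Rightarrow fx\asymp fy$), with pointwise equivalence $f\asymp g:=\forall x.\,fx\asymp gx$. Propositions form a setoid under logical equivalence, and $\wp Y:=Y\to\star$ is the setoid of respectful predicates on $Y$; write $y\in\mathcal{Y}$ for $\mathcal{Y}\,y$. A subsetoid $\Sigma a\colon X.\,Pa$ has as equivalence the equivalence of the first projections in $X$; first projections are left implicit. For a stable setoid $Y$, the setoid of weak partial values over $Y$ is the subsetoid of $\wp Y$ $$\mathfrak{P}Y:=\Sigma\mathcal{Y}\colon\wp Y.\,(\forall y.\,\neg\neg\, y\in\mathcal{Y}\Rightarrow y\in\mathcal{Y})\wedge(\forall y_1\,y_2.\,y_1\in\mathcal{Y}\Rightarrow y_2\in\mathcal{Y}\Rightarrow y_1\asymp y_2),$$ and the setoid of weak values over $Y$ is the subsetoid of $\mathfrak{P}Y$ $$\mathfrak{V}Y:=\Sigma\mathcal{Y}\colon\mathfrak{P}Y.\,\exists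 y.\,y\in\mathcal{Y}.$$ The operations for $\mathfrak{P}$ are $$\mathrm{unit}_{\mathfrak{P}}\,x_0:=\{x\colon X\mid x\asymp x_0\},\qquad \mathrm{map}_{\mathfrak{P}}\,f\,\mathcal{X}:=\{y\colon Y\mid\exists x.\,x\in\mathcal{X}\wedge fx\asymp y\},\qquad \mathrm{join}_{\mathfrak{P}}\,\mathcal{X}:=\mathcal{X}\circ\mathrm{unit}_{\mathfrak{P}},$$ i.e. $x\in\mathrm{join}_{\mathfrak{P}}\mathcal{X}$ iff $\mathrm{unit}_{\mathfrak{P}}\,x\in\mathcal{X}$. The operations $\mathrm{unit}_{\mathfrak{V}},\mathrm{map}_{\mathfrak{V}},\mathrm{join}_{\mathfrak{V}}$ are defined by the same formulas with $\mathfrak{V}$ in place of $\mathfrak{P}$. -}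

module Defs where

open import Data.Product using (Σ; _×_; proj₁; proj₂)
open import Function.Bundles using (Func; _⟨$⟩_; _⇔_)
open import Function.Construct.Composition using (function)
open import Function.Properties.Equivalence using (⇔-setoid)
open import Function.Relation.Binary.Setoid.Equality using (_⇨_)
open import Level using (Level; _⊔_; suc; Setω)
open import Relation.Binary.Bundles using (Setoid)
import Relation.Binary.Construct.On as On
open import Relation.Binary.Definitions using (Stable)
open import Relation.Nullary.Negation.Core using (¬_)
import Relation.Nullary.Negation.Core as Nullary

open Setoid using (Carrier)

record StableSetoid (c ℓ : Level) : Set (suc (c ⊔ ℓ)) where
  field
    setoid : Setoid c ℓ
    stable : Stable (Setoid._≈_ setoid)
  open Setoid setoid public using (_≈_)

open StableSetoid using (setoid)

∣_∣ : ∀ {c ℓ} → StableSetoid c ℓ → Set c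
∣ X ∣ = Carrier (setoid X)

-- The weak (classical) existential.
∃ʷ : ∀ {a b} {A : Set a} → (A → Set b) → Set (a ⊔ b)
∃ʷ φ = ¬ (∀ a → ¬ φ a)

Subsetoid : ∀ {c ℓ p} (X : Setoid c ℓ) → (Carrier X → Set p) → Setoid (c ⊔ p) ℓ
Subsetoid X P = On.setoid X (proj₁ {B = P})

-- Respectful predicates valued in Set p, propositions being identified up to
-- logical equivalence.
℘ : ∀ {c ℓ} p → Setoid c ℓ → Setoid (c ⊔ ℓ ⊔ suc p) (c ⊔ p)
℘ p Y = Y ⇨ ⇔-setoid p

-- Agda's universes are predicative, so the level of the predicates has to be
-- tracked.  It is ℓ ⊔ p with p arbitrary, i.e. any level that accommodates the
-- equivalence of Y, as needed for { y ∣ y ≈ y₀ } to be a value.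
𝔓 : ∀ {c ℓ} p → StableSetoid c ℓ → Setoid (c ⊔ suc ℓ ⊔ suc p) (c ⊔ ℓ ⊔ p)
𝔓 {ℓ = ℓ} p Y = Subsetoid (℘ (ℓ ⊔ p) (setoid Y)) λ 𝒴 →
    (∀ y → Nullary.Stable (𝒴 ⟨$⟩ y))
  × (∀ y₁ y₂ → 𝒴 ⟨$⟩ y₁ → 𝒴 ⟨$⟩ y₂ → y₁ ≈ y₂)
  where open StableSetoid Y using (_≈_)

𝔙 : ∀ {c ℓ} p → StableSetoid c ℓ → Setoid (c ⊔ suc ℓ ⊔ suc p) (c ⊔ ℓ ⊔ p)
𝔙 p Y = Subsetoid (𝔓 p Y) λ 𝒴 → ∃ʷ λ y → proj₁ 𝒴 ⟨$⟩ y

infixr 9 _∘_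
_∘_ : ∀ {a₁ a₂ b₁ b₂ c₁ c₂} {A : Setoid a₁ a₂} {B : Setoid b₁ b₂} {C : Setoid c₁ c₂} →
      Func B C → Func A B → Func A C
g ∘ f = function f g

data Kind : Set where
  partial total : Kind

Weak : Kind → ∀ {c ℓ} p → StableSetoid c ℓ → Setoid (c ⊔ suc ℓ ⊔ suc p) (c ⊔ ℓ ⊔ p)
Weak partial = 𝔓
Weak total   = 𝔙

predicate : ∀ κ {c ℓ p} {Y : StableSetoid c ℓ} →
            Carrier (Weak κ p Y) → Carrier (℘ (ℓ ⊔ p) (setoid Y))
predicate partial 𝒴 = proj₁ 𝒴
predicate total   𝒴 = proj₁ (proj₁ 𝒴)

-- The operations are specified by their membership conditions; as the
-- equivalence of Weak κ p Y is logical equivalence of predicates, these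
-- determine them uniquely up to it.  Well-definedness of the operations is the
-- fact that they are elements of Func.
record IsMonad (κ : Kind) : Setω where
  field
    weak-stable : ∀ {c ℓ} p (X : StableSetoid c ℓ) →
                  Stable (Setoid._≈_ (Weak κ p X))

  𝔐 : ∀ {c ℓ} p → StableSetoid c ℓ → StableSetoid (c ⊔ suc ℓ ⊔ suc p) (c ⊔ ℓ ⊔ p)
  𝔐 p X = record { setoid = Weak κ p X ; stable = weak-stable p X }

  infix 4 _∈_ _≍_

  _∈_ : ∀ {c ℓ p} {Y : StableSetoid c ℓ} → ∣ Y ∣ → ∣ 𝔐 p Y ∣ → Set (ℓ ⊔ p)
  y ∈ 𝒴 = predicate κ 𝒴 ⟨$⟩ y

  -- The equivalence of X → 𝔐 Y, also between different predicate levels.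
  _≍_ : ∀ {c ℓ c′ ℓ′ p q} {X : Setoid c ℓ} {Y : StableSetoid c′ ℓ′} →
        Func X (setoid (𝔐 p Y)) → Func X (setoid (𝔐 q Y)) →
        Set (c ⊔ c′ ⊔ ℓ′ ⊔ p ⊔ q)
  k ≍ l = ∀ x y → y ∈ (k ⟨$⟩ x) ⇔ y ∈ (l ⟨$⟩ x)

  field
    unit : ∀ {c ℓ} p (X : StableSetoid c ℓ) → Func (setoid X) (setoid (𝔐 p X))

    map : ∀ {c ℓ c′ ℓ′} p (X : StableSetoid c ℓ) (Y : StableSetoid c′ ℓ′) →
          Func (setoid X ⇨ setoid Y) (setoid (𝔐 p X) ⇨ setoid (𝔐 (c ⊔ ℓ ⊔ p) Y))

    join : ∀ {c ℓ} p q (X : StableSetoid c ℓ) →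
           Func (setoid (𝔐 q (𝔐 p X))) (setoid (𝔐 (c ⊔ p ⊔ q) X))

    ∈-unit : ∀ {c ℓ} p (X : StableSetoid c ℓ) (x₀ x : ∣ X ∣) →
             x ∈ (unit p X ⟨$⟩ x₀) ⇔ StableSetoid._≈_ X x x₀

    ∈-map : ∀ {c ℓ c′ ℓ′} p (X : StableSetoid c ℓ) (Y : StableSetoid c′ ℓ′)
            (f : Func (setoid X) (setoid Y)) (𝒳 : ∣ 𝔐 p X ∣) (y : ∣ Y ∣) →
            y ∈ (map p X Y ⟨$⟩ f ⟨$⟩ 𝒳) ⇔
            ∃ʷ λ x → x ∈ 𝒳 × StableSetoid._≈_ Y (f ⟨$⟩ x) y

    ∈-join : ∀ {c ℓ} p q (X : StableSetoid c ℓ) (𝒳 : ∣ 𝔐 q (𝔐 p X) ∣) (x : ∣ X ∣) →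
             x ∈ (join p q X ⟨$⟩ 𝒳) ⇔ (unit p X ⟨$⟩ x) ∈ 𝒳

  bind : ∀ {c ℓ c′ ℓ′ p q} {X : StableSetoid c ℓ} {Y : StableSetoid c′ ℓ′} →
         Func (setoid X) (setoid (𝔐 q Y)) →
         Func (setoid (𝔐 p X)) (setoid (𝔐 (c ⊔ ℓ ⊔ c′ ⊔ p ⊔ q) Y))
  bind {c} {ℓ} {p = p} {q = q} {X = X} {Y = Y} k =
    join q (c ⊔ ℓ ⊔ p) Y ∘ (map p X (𝔐 q Y) ⟨$⟩ k)

  infixr 9 _⋘_
  _⋘_ : ∀ {b m c ℓ c′ ℓ′ p q}
        {W : Setoid b m} {X : StableSetoid c ℓ} {Y : StableSetoid c′ ℓ′} →
        Func (setoid X) (setoid (𝔐 q Y)) → Func W (setoid (𝔐 p X)) →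
        Func W (setoid (𝔐 (c ⊔ ℓ ⊔ c′ ⊔ p ⊔ q) Y))
  _⋘_ {X = X} k l = bind {X = X} k ∘ l

  field
    identityʳ : ∀ {c ℓ c′ ℓ′ p} q (Y : StableSetoid c ℓ) (Z : StableSetoid c′ ℓ′)
                (f : Func (setoid Y) (setoid (𝔐 p Z))) →
                f ⋘ unit q Y ≍ f

    identityˡ : ∀ {c ℓ c′ ℓ′ p} q (Y : StableSetoid c ℓ) (Z : StableSetoid c′ ℓ′)
                (f : Func (setoid Y) (setoid (𝔐 p Z))) →
                unit q Z ⋘ f ≍ f

    assoc : ∀ {c₁ ℓ₁ c₂ ℓ₂ c₃ ℓ₃ c₄ ℓ₄ p q r}
            (W : StableSetoid c₁ ℓ₁) (X : StableSetoid c₂ ℓ₂)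
            (Y : StableSetoid c₃ ℓ₃) (Z : StableSetoid c₄ ℓ₄)
            (f : Func (setoid Y) (setoid (𝔐 p Z)))
            (g : Func (setoid X) (setoid (𝔐 q Y)))
            (h : Func (setoid W) (setoid (𝔐 r X))) →
            f ⋘ (g ⋘ h) ≍ (f ⋘ g) ⋘ h

-- A subsingleton 𝒴 containing x is { y ∣ y ≍ x }, so for k : X → 𝔐 Y the
-- condition k x ≍ unit y says y ∈ k x, and bind k 𝒳 is
-- { y ∣ ∃ x. x ∈ 𝒳 ∧ y ∈ k x }.  In this form the monad laws are the usual ones
-- for images under relations; as membership is stable, the weak existential can
-- be eliminated into it.

module Submission where

open import Data.Product using (_×_; _,_)
open import Function.Bundles using (Func; _⟨$⟩_; _⇔_; mk⇔; Equivalence)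
import Function.Properties.Equivalence as ⇔
open import Function.Relation.Binary.Setoid.Equality using (_⇨_)
open import Level using (Level; _⊔_; Lift; lift; lower)
open import Relation.Binary.Bundles using (Setoid)
open import Relation.Binary.Definitions using (_Respects_)
open import Relation.Binary.PropositionalEquality.Core using (_≡_; refl)
open import Relation.Nullary.Negation.Core using (Stable; negated-stable)

open import Defs

open Equivalence using (to; from)
open Func using (cong)
open Setoid using (Carrier)
open StableSetoid using (setoid)

private
  variable
    a b c ℓ c′ ℓ′ p q : Level

∃ʷ-intro : {A : Set a} {φ : A → Set b} (x : A) → φ x → ∃ʷ φ
∃ʷ-intro x φx ∄ = ∄ x φx

-- Under `¬ C` every `φ x` is refuted, which contradicts the weak existential; so `C` is not false,
-- and stability yields it.
∃ʷ-elim : {A : Set a} {φ : A → Set b} {C : Set c} → Stable C →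
          (∀ x → φ x → C) → ∃ʷ φ → C
∃ʷ-elim C-stable k ∃φ = C-stable λ ¬c → ∃φ λ x φx → ¬c (k x φx)

-- A weak existential is a negation, hence stable, so another one can be eliminated into it.
∃ʷ-map : {A : Set a} {B : Set b} {φ : A → Set p} {ψ : B → Set q} →
         (f : A → B) → (∀ x → φ x → ψ (f x)) → ∃ʷ φ → ∃ʷ ψ
∃ʷ-map f φ⇒ψ = ∃ʷ-elim negated-stable λ x φx → ∃ʷ-intro (f x) (φ⇒ψ x φx)

respectful : (Y : Setoid c ℓ) (P : Carrier Y → Set p) →
             P Respects Setoid._≈_ Y → Carrier (℘ p Y)
respectful Y P resp = record
  { to   = P
  ; cong = λ x≈y → mk⇔ (resp x≈y) (resp (Setoid.sym Y x≈y))
  }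

-- Inhabitation is demanded only when `κ ≡ total`, so that a single construction of each operation
-- serves both kinds.
weak : ∀ κ p (Y : StableSetoid c ℓ) (𝒴 : Carrier (℘ (ℓ ⊔ p) (setoid Y))) →
       (∀ y → Stable (𝒴 ⟨$⟩ y)) →
       (∀ y₁ y₂ → 𝒴 ⟨$⟩ y₁ → 𝒴 ⟨$⟩ y₂ → StableSetoid._≈_ Y y₁ y₂) →
       (κ ≡ total → ∃ʷ λ y → 𝒴 ⟨$⟩ y) →
       Carrier (Weak κ p Y)
weak partial p Y 𝒴 st un inh = 𝒴 , st , un
weak total   p Y 𝒴 st un inh = (𝒴 , st , un) , inh refl

-- `weak κ` and `predicate κ` reduce only when `κ` is a constructor. The lemmas from here to `⇔⇒≈`
-- do the case split, so that `κ` can stay a variable afterwards.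
∈-weak : ∀ κ p (Y : StableSetoid c ℓ) (𝒴 : Carrier (℘ (ℓ ⊔ p) (setoid Y))) st un inh y →
         predicate κ {Y = Y} (weak κ p Y 𝒴 st un inh) ⟨$⟩ y ⇔ 𝒴 ⟨$⟩ y
∈-weak partial p Y 𝒴 st un inh y = ⇔.refl
∈-weak total   p Y 𝒴 st un inh y = ⇔.refl

∈-stable : ∀ κ p (Y : StableSetoid c ℓ) (𝒴 : Carrier (Weak κ p Y)) y →
           Stable (predicate κ {Y = Y} 𝒴 ⟨$⟩ y)
∈-stable partial p Y (_ , st , _)       = st
∈-stable total   p Y ((_ , st , _) , _) = st

∈-unique : ∀ κ p (Y : StableSetoid c ℓ) (𝒴 : Carrier (Weak κ p Y)) y₁ y₂ →
           predicate κ {Y = Y} 𝒴 ⟨$⟩ y₁ → predicate κ {Y = Y} 𝒴 ⟨$⟩ y₂ →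
           StableSetoid._≈_ Y y₁ y₂
∈-unique partial p Y (_ , _ , un)       = un
∈-unique total   p Y ((_ , _ , un) , _) = un

∈-inhabited : ∀ κ p (Y : StableSetoid c ℓ) (𝒴 : Carrier (Weak κ p Y)) → κ ≡ total →
              ∃ʷ λ y → predicate κ {Y = Y} 𝒴 ⟨$⟩ y
∈-inhabited total p Y (_ , inh) refl = inh

≈⇒⇔ : ∀ κ p (Y : StableSetoid c ℓ) {𝒴 𝒵 : Carrier (Weak κ p Y)} →
      Setoid._≈_ (Weak κ p Y) 𝒴 𝒵 →
      ∀ y → predicate κ {Y = Y} 𝒴 ⟨$⟩ y ⇔ predicate κ {Y = Y} 𝒵 ⟨$⟩ y
≈⇒⇔ partial p Y 𝒴≈𝒵 = 𝒴≈𝒵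
≈⇒⇔ total   p Y 𝒴≈𝒵 = 𝒴≈𝒵

⇔⇒≈ : ∀ κ p (Y : StableSetoid c ℓ) {𝒴 𝒵 : Carrier (Weak κ p Y)} →
      (∀ y → predicate κ {Y = Y} 𝒴 ⟨$⟩ y ⇔ predicate κ {Y = Y} 𝒵 ⟨$⟩ y) →
      Setoid._≈_ (Weak κ p Y) 𝒴 𝒵
⇔⇒≈ partial p Y 𝒴⇔𝒵 = 𝒴⇔𝒵
⇔⇒≈ total   p Y 𝒴⇔𝒵 = 𝒴⇔𝒵

module WeakMonad (κ : Kind) where

  -- Both inclusions end in a membership, which is stable, so the double negation can be removed
  -- pointwise.
  weak-stable : ∀ p (X : StableSetoid c ℓ) (𝒳 𝒴 : Carrier (Weak κ p X)) →
                Stable (Setoid._≈_ (Weak κ p X) 𝒳 𝒴)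
  weak-stable p X 𝒳 𝒴 ¬¬𝒳≈𝒴 = ⇔⇒≈ κ p X λ x → mk⇔
    (λ x∈𝒳 → ∈-stable κ p X 𝒴 x λ x∉𝒴 → ¬¬𝒳≈𝒴 λ 𝒳≈𝒴 →
               x∉𝒴 (to (≈⇒⇔ κ p X 𝒳≈𝒴 x) x∈𝒳))
    (λ x∈𝒴 → ∈-stable κ p X 𝒳 x λ x∉𝒳 → ¬¬𝒳≈𝒴 λ 𝒳≈𝒴 →
               x∉𝒳 (from (≈⇒⇔ κ p X 𝒳≈𝒴 x) x∈𝒴))

  𝔐 : ∀ p → StableSetoid c ℓ → StableSetoid _ _
  𝔐 p X = record { setoid = Weak κ p X ; stable = weak-stable p X }

  infix 4 _∈_
  _∈_ : {Y : StableSetoid c ℓ} → ∣ Y ∣ → ∣ 𝔐 p Y ∣ → Set (ℓ ⊔ p)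
  _∈_ {Y = Y} y 𝒴 = predicate κ {Y = Y} 𝒴 ⟨$⟩ y

  ∈-resp : ∀ p (Y : StableSetoid c ℓ) (𝒴 : ∣ 𝔐 p Y ∣) →
           (λ y → _∈_ {p = p} {Y = Y} y 𝒴) Respects StableSetoid._≈_ Y
  ∈-resp p Y 𝒴 y≈y′ = to (cong (predicate κ {Y = Y} 𝒴) y≈y′)

  module _ (p : Level) (X : StableSetoid c ℓ) where
    private module X = Setoid (setoid X)

    -- `Lift` raises the equivalence of `X` from level `ℓ` to the level `ℓ ⊔ p` of the predicates.
    singleton : ∣ X ∣ → Carrier (℘ (ℓ ⊔ p) (setoid X))
    singleton x₀ = respectful (setoid X) (λ x → Lift p (x X.≈ x₀))
      λ x≈y (lift x≈x₀) → lift (X.trans (X.sym x≈y) x≈x₀)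

    unit₀ : ∣ X ∣ → ∣ 𝔐 p X ∣
    unit₀ x₀ = weak κ p X (singleton x₀)
      (λ x ¬¬x≈x₀ → lift (StableSetoid.stable X x x₀ λ x≉x₀ → ¬¬x≈x₀ λ (lift x≈x₀) → x≉x₀ x≈x₀))
      (λ x y (lift x≈x₀) (lift y≈x₀) → X.trans x≈x₀ (X.sym y≈x₀))
      (λ _ → ∃ʷ-intro x₀ (lift X.refl))

    ∈-unit : (x₀ x : ∣ X ∣) → _∈_ {p = p} {Y = X} x (unit₀ x₀) ⇔ x X.≈ x₀
    ∈-unit x₀ x = ⇔.trans (∈-weak κ p X (singleton x₀) _ _ _ x) (mk⇔ lower lift)

    unit : Func (setoid X) (setoid (𝔐 p X))
    unit = record
      { to   = unit₀
      ; cong = λ {x₀} {x₁} x₀≈x₁ → ⇔⇒≈ κ p X λ x → mk⇔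
          (λ x∈ → from (∈-unit x₁ x) (X.trans (to (∈-unit x₀ x) x∈) x₀≈x₁))
          (λ x∈ → from (∈-unit x₀ x) (X.trans (to (∈-unit x₁ x) x∈) (X.sym x₀≈x₁)))
      }

    -- Left to right, `x` lies in `unit₀ x`. Right to left, one inclusion is uniqueness of elements,
    -- the other respectfulness of membership.
    ≈unit⇔∋ : (𝒳 : ∣ 𝔐 p X ∣) (x : ∣ X ∣) →
              StableSetoid._≈_ (𝔐 p X) 𝒳 (unit₀ x) ⇔ _∈_ {p = p} {Y = X} x 𝒳
    ≈unit⇔∋ 𝒳 x = mk⇔
      (λ 𝒳≈x → from (≈⇒⇔ κ p X 𝒳≈x x) (from (∈-unit x x) X.refl))
      (λ x∈𝒳 → ⇔⇒≈ κ p X λ y → mk⇔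
        (λ y∈𝒳 → from (∈-unit x y) (∈-unique κ p X 𝒳 y x y∈𝒳 x∈𝒳))
        (λ y∈x → ∈-resp p X 𝒳 (X.sym (to (∈-unit x y) y∈x)) x∈𝒳))

  module _ {c ℓ c′ ℓ′} (p : Level) (X : StableSetoid c ℓ) (Y : StableSetoid c′ ℓ′) where
    private
      module X = Setoid (setoid X)
      module Y = Setoid (setoid Y)

    image : Func (setoid X) (setoid Y) → ∣ 𝔐 p X ∣ →
            Carrier (℘ (c ⊔ ℓ ⊔ ℓ′ ⊔ p) (setoid Y))
    image f 𝒳 = respectful (setoid Y)
      (λ y → ∃ʷ λ x → _∈_ {p = p} {Y = X} x 𝒳 × f ⟨$⟩ x Y.≈ y)
      λ y≈y′ → ∃ʷ-map (λ x → x) λ x (x∈𝒳 , fx≈y) → x∈𝒳 , Y.trans fx≈y y≈y′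

    map₀ : Func (setoid X) (setoid Y) → ∣ 𝔐 p X ∣ → ∣ 𝔐 (c ⊔ ℓ ⊔ p) Y ∣
    map₀ f 𝒳 = weak κ _ Y (image f 𝒳)
      (λ y → negated-stable)
      -- Stability of the equivalence of `Y` allows both weak existentials to be opened; the
      -- preimages agree by uniqueness in `𝒳`, and `f` respects this.
      (λ y₁ y₂ y₁∈ y₂∈ →
        ∃ʷ-elim (StableSetoid.stable Y y₁ y₂) (λ x₁ (x₁∈𝒳 , fx₁≈y₁) →
        ∃ʷ-elim (StableSetoid.stable Y y₁ y₂) (λ x₂ (x₂∈𝒳 , fx₂≈y₂) →
          Y.trans (Y.sym fx₁≈y₁)
            (Y.trans (cong f (∈-unique κ p X 𝒳 x₁ x₂ x₁∈𝒳 x₂∈𝒳)) fx₂≈y₂)) y₂∈) y₁∈)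
      (λ κ≡total → ∃ʷ-map (f ⟨$⟩_) (λ x x∈𝒳 → ∃ʷ-intro x (x∈𝒳 , Y.refl))
        (∈-inhabited κ p X 𝒳 κ≡total))

    ∈-map : (f : Func (setoid X) (setoid Y)) (𝒳 : ∣ 𝔐 p X ∣) (y : ∣ Y ∣) →
            _∈_ {p = c ⊔ ℓ ⊔ p} {Y = Y} y (map₀ f 𝒳) ⇔
            ∃ʷ λ x → _∈_ {p = p} {Y = X} x 𝒳 × f ⟨$⟩ x Y.≈ y
    ∈-map f 𝒳 = ∈-weak κ _ Y (image f 𝒳) _ _ _

    -- Function and argument vary together, so that one statement yields respectfulness both of
    -- `map₀ f` and of `map` in `f`.
    map₀-mono : (f g : Func (setoid X) (setoid Y)) (𝒳 𝒳′ : ∣ 𝔐 p X ∣) →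
                (∀ x → f ⟨$⟩ x Y.≈ g ⟨$⟩ x) →
                StableSetoid._≈_ (𝔐 p X) 𝒳 𝒳′ →
                ∀ y → _∈_ {p = c ⊔ ℓ ⊔ p} {Y = Y} y (map₀ f 𝒳) →
                      _∈_ {p = c ⊔ ℓ ⊔ p} {Y = Y} y (map₀ g 𝒳′)
    map₀-mono f g 𝒳 𝒳′ f≈g 𝒳≈𝒳′ y y∈ = from (∈-map g 𝒳′ y)
      (∃ʷ-map (λ x → x)
        (λ x (x∈𝒳 , fx≈y) → to (≈⇒⇔ κ p X 𝒳≈𝒳′ x) x∈𝒳 , Y.trans (Y.sym (f≈g x)) fx≈y)
        (to (∈-map f 𝒳 y) y∈))

    map₀-cong : (f g : Func (setoid X) (setoid Y)) (𝒳 𝒳′ : ∣ 𝔐 p X ∣) →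
                (∀ x → f ⟨$⟩ x Y.≈ g ⟨$⟩ x) →
                StableSetoid._≈_ (𝔐 p X) 𝒳 𝒳′ →
                StableSetoid._≈_ (𝔐 (c ⊔ ℓ ⊔ p) Y) (map₀ f 𝒳) (map₀ g 𝒳′)
    map₀-cong f g 𝒳 𝒳′ f≈g 𝒳≈𝒳′ = ⇔⇒≈ κ _ Y λ y → mk⇔
      (map₀-mono f g 𝒳 𝒳′ f≈g 𝒳≈𝒳′ y)
      (map₀-mono g f 𝒳′ 𝒳 (λ x → Y.sym (f≈g x)) (Setoid.sym (setoid (𝔐 p X)) 𝒳≈𝒳′) y)

    map : Func (setoid X ⇨ setoid Y) (setoid (𝔐 p X) ⇨ setoid (𝔐 (c ⊔ ℓ ⊔ p) Y))
    map = record
      { to   = λ f → record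
        { to   = map₀ f
        ; cong = λ {𝒳} {𝒳′} → map₀-cong f f 𝒳 𝒳′ λ _ → Y.refl
        }
      ; cong = λ {f} {g} f≈g 𝒳 →
          map₀-cong f g 𝒳 𝒳 f≈g (Setoid.refl (setoid (𝔐 p X)))
      }

  module _ {c ℓ} (p q : Level) (X : StableSetoid c ℓ) where

    singletons-in : ∣ 𝔐 q (𝔐 p X) ∣ → Carrier (℘ (c ⊔ ℓ ⊔ p ⊔ q) (setoid X))
    singletons-in 𝒳 = predicate κ {Y = 𝔐 p X} 𝒳 ∘ unit p X

    join₀ : ∣ 𝔐 q (𝔐 p X) ∣ → ∣ 𝔐 (c ⊔ p ⊔ q) X ∣
    join₀ 𝒳 = weak κ _ X (singletons-in 𝒳)
      (λ x → ∈-stable κ q (𝔐 p X) 𝒳 (unit₀ p X x))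
      -- Uniqueness in `𝒳` identifies the units of `x` and `y`; hence `x` lies in the unit of `y`.
      (λ x y x∈ y∈ →
        to (∈-unit p X y x)
          (to (≈unit⇔∋ p X (unit₀ p X y) x) (∈-unique κ q (𝔐 p X) 𝒳 _ _ y∈ x∈)))
      -- Weakly there are `𝒴` in `𝒳` and `x` in `𝒴`. Then `𝒴` is equivalent to the unit of `x`,
      -- which therefore lies in `𝒳`.
      (λ κ≡total → ∃ʷ-elim negated-stable
        (λ 𝒴 𝒴∈𝒳 → ∃ʷ-map (λ x → x)
          (λ x x∈𝒴 → ∈-resp q (𝔐 p X) 𝒳 (from (≈unit⇔∋ p X 𝒴 x) x∈𝒴) 𝒴∈𝒳)
          (∈-inhabited κ p X 𝒴 κ≡total))
        (∈-inhabited κ q (𝔐 p X) 𝒳 κ≡total))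

    ∈-join : (𝒳 : ∣ 𝔐 q (𝔐 p X) ∣) (x : ∣ X ∣) →
             _∈_ {p = c ⊔ p ⊔ q} {Y = X} x (join₀ 𝒳) ⇔
             _∈_ {p = q} {Y = 𝔐 p X} (unit₀ p X x) 𝒳
    ∈-join 𝒳 = ∈-weak κ _ X (singletons-in 𝒳) _ _ _

    join : Func (setoid (𝔐 q (𝔐 p X))) (setoid (𝔐 (c ⊔ p ⊔ q) X))
    join = record
      { to   = join₀
      ; cong = λ {𝒳} {𝒴} 𝒳≈𝒴 → ⇔⇒≈ κ _ X λ x →
          ⇔.trans (∈-join 𝒳 x)
            (⇔.trans (≈⇒⇔ κ q (𝔐 p X) 𝒳≈𝒴 (unit₀ p X x)) (⇔.sym (∈-join 𝒴 x)))
      }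

  module _ {c ℓ c′ ℓ′} (p q : Level) (X : StableSetoid c ℓ) (Y : StableSetoid c′ ℓ′) where

    bind : Func (setoid X) (setoid (𝔐 q Y)) →
           Func (setoid (𝔐 p X)) (setoid (𝔐 (c ⊔ ℓ ⊔ c′ ⊔ p ⊔ q) Y))
    bind k = join q (c ⊔ ℓ ⊔ p) Y ∘ (map p X (𝔐 q Y) ⟨$⟩ k)

    -- The monad laws are all derived from this relational form of `bind`.
    ∈-bind : (k : Func (setoid X) (setoid (𝔐 q Y))) (𝒳 : ∣ 𝔐 p X ∣) (y : ∣ Y ∣) →
             _∈_ {p = c ⊔ ℓ ⊔ c′ ⊔ p ⊔ q} {Y = Y} y (bind k ⟨$⟩ 𝒳) ⇔
             ∃ʷ λ x → _∈_ {p = p} {Y = X} x 𝒳 × _∈_ {p = q} {Y = Y} y (k ⟨$⟩ x)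
    ∈-bind k 𝒳 y =
      ⇔.trans (∈-join q _ Y (map₀ p X (𝔐 q Y) k 𝒳) y)
      (⇔.trans (∈-map p X (𝔐 q Y) k 𝒳 (unit₀ q Y y))
      (mk⇔
        (∃ʷ-map (λ x → x) λ x (x∈𝒳 , kx≈y) → x∈𝒳 , to (≈unit⇔∋ q Y (k ⟨$⟩ x) y) kx≈y)
        (∃ʷ-map (λ x → x) λ x (x∈𝒳 , y∈kx) → x∈𝒳 , from (≈unit⇔∋ q Y (k ⟨$⟩ x) y) y∈kx)))

mainTheorem1 : (κ : Kind) → IsMonad κ
mainTheorem1 κ = record
  { weak-stable = weak-stable
  ; unit        = unit
  ; map         = map
  ; join        = join
  ; ∈-unit      = ∈-unit
  ; ∈-map       = ∈-map
  ; ∈-join      = ∈-join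
  -- The only candidate for the intermediate value is `y` up to equivalence, and `f` respects that
  -- equivalence.
  ; identityʳ   = λ {p = p} q Y Z f y z → ⇔.trans (∈-bind q p Y Z f (unit₀ q Y y) z) (mk⇔
      (∃ʷ-elim (∈-stable κ p Z (f ⟨$⟩ y) z) λ y′ (y′∈y , z∈fy′) →
        to (≈⇒⇔ κ p Z (cong f (to (∈-unit q Y y y′) y′∈y)) z) z∈fy′)
      (λ z∈fy → ∃ʷ-intro y (from (∈-unit q Y y y) (Setoid.refl (setoid Y)) , z∈fy)))
  -- Here the intermediate value is `z` itself up to equivalence, and membership in `f ⟨$⟩ y`
  -- respects it.
  ; identityˡ   = λ {p = p} q Y Z f y z → ⇔.trans (∈-bind p q Z Z (unit q Z) (f ⟨$⟩ y) z) (mk⇔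
      (∃ʷ-elim (∈-stable κ p Z (f ⟨$⟩ y) z) λ z′ (z′∈fy , z∈z′) →
        ∈-resp p Z (f ⟨$⟩ y) (Setoid.sym (setoid Z) (to (∈-unit q Z z′ z) z∈z′)) z′∈fy)
      (λ z∈fy → ∃ʷ-intro z (z∈fy , from (∈-unit q Z z z) (Setoid.refl (setoid Z)))))
  -- Both sides assert weakly an `x` in `h ⟨$⟩ w` and a `y` in `g ⟨$⟩ x` with `z` in `f ⟨$⟩ y`; only
  -- the nesting of the two existentials differs.
  ; assoc       = λ {p = p} {q} {r} W X Y Z f g h w z →
      ⇔.trans (∈-bind _ p Y Z f (bind r q X Y g ⟨$⟩ (h ⟨$⟩ w)) z)
      (⇔.trans (mk⇔
        (∃ʷ-elim negated-stable λ y (y∈gh , z∈fy) →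
          ∃ʷ-map (λ x → x) (λ x (x∈h , y∈gx) →
            x∈h , from (∈-bind q p Y Z f (g ⟨$⟩ x) z) (∃ʷ-intro y (y∈gx , z∈fy)))
            (to (∈-bind r q X Y g (h ⟨$⟩ w) y) y∈gh))
        (∃ʷ-elim negated-stable λ x (x∈h , z∈fgx) →
          ∃ʷ-map (λ y → y) (λ y (y∈gx , z∈fy) →
            from (∈-bind r q X Y g (h ⟨$⟩ w) y) (∃ʷ-intro x (x∈h , y∈gx)) , z∈fy)
            (to (∈-bind q p Y Z f (g ⟨$⟩ x) z) z∈fgx)))
      (⇔.sym (∈-bind r _ X Z (bind q p Y Z f ∘ g) (h ⟨$⟩ w) z)))
  }
  where open WeakMonad κ
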